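{- Consider M-FACTORING, and let $n\geqslant 2$, where each option is a non-trivial disjunctive sum of a factoring of $n$. Then $\mathcal{SG}(n)=\Omega(n)-1$. If no two distinct components may contain the same prime number, then $\mathcal{SG}(n)=\omega(n)-1$.
   Context: M-FACTORING is the impartial normal-play heap game where a move from a heap $n$ replaces it by the disjunctive sum $a_1+\cdots+a_k$ of a factorization $n=a_1a_2\cdots a_k$ with $k\ge2$ and $1<a_1\le\cdots\le a_k$. $\mathcal{SG}$ denotes the Sprague-Grundy value (mex rule, nim-sum). $\Omega(n)$ counts prime factors with multiplicity, $\omega(n)$ counts distinct prime factors. -}

module Defs where

open import Data.Bool.Base using (if_then_else_)
open import Data.List.Base using (List; []; _∷_; _++_; map; foldr; length; filter; upTo; cartesianProductWith; deduplicate)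
open import Data.List.Extrema.Nat using (max; xs≤max)
open import Data.List.Membership.DecPropositional using () renaming (_∈?_ to mem?)
open import Data.List.Membership.Propositional using (_∈_; _∉_; mapWith∈)
open import Data.List.Membership.Propositional.Properties using (∈-filter⁺; ∈-filter⁻; ∈-upTo⁺; ∈-cartesianProductWith⁺; mapWith∈-cong; mapWith∈≗map)
open import Data.List.Relation.Unary.All as All using (All; []; _∷_)
open import Data.List.Relation.Unary.AllPairs using (AllPairs; allPairs?)
open import Data.List.Relation.Unary.Any using (here; there)
open import Data.List.Relation.Unary.Linked using (Linked; linked?)
open import Data.Nat.Base using (ℕ; zero; suc; _+_; _*_; _^_; _≤_; _<_; z≤n; s≤s; NonZero; >-nonZero)
open import Data.Nat.Coprimality using (Coprime; coprime?)
open import Data.Nat.Divisibility using (_∣_; _∣?_; ∣-trans; ∣⇒≤; _∣0; m∣m*n)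
open import Data.Nat.Induction using (<-wellFounded)
open import Data.Nat.ListAction using (product)
open import Data.Nat.ListAction.Properties using (∈⇒∣product)
open import Data.Nat.Logarithm using (⌊log₂_⌋; ⌊log₂⌋-mono-≤; ⌊log₂[2^n]⌋≡n)
open import Data.Nat.Primality using (Prime; prime[2]; ¬prime[1])
open import Data.Nat.Primality.Factorisation using (factorise; factors; PrimeFactorisation)
open import Data.Nat.Properties using (_≟_; _≤?_; _<?_; ≤-refl; ≤-trans; ≤-<-trans; <⇒≤; <-irrefl; m<m*n; *-comm; *-mono-≤; m<1+n⇒m<n∨m≡n; +-suc; +-identityʳ)
open import Data.Product.Base using (_×_; _,_; proj₁; proj₂)
open import Data.Sum.Base using (inj₁; inj₂)
open import Function.Base using (_∘_)
open import Function.Bundles using (_⇔_; mk⇔)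
open import Induction.WellFounded using (Acc; acc)
open import Level using (0ℓ)
open import Relation.Binary.PropositionalEquality using (_≡_; refl; sym; trans; cong; subst)
open import Relation.Nullary.Decidable using (Dec; yes; no; does; map′; _×-dec_)
open import Relation.Nullary.Negation using (¬_; contradiction)
open import Relation.Unary using (Pred; Decidable; U)
open import Relation.Unary.Properties using (U?)

-- A finite impartial game is the list of its options.

data Game : Set where
  ⟨_⟩ : List Game → Game

-- The options of G ⊞ H are the G′ ⊞ H and the G ⊞ H′, for G′ an option of G
-- and H′ an option of H; moveˡ gs H is map (_⊞ H) gs and moveʳ G hs is
-- map (G ⊞_) hs, written out for the termination checker.

infixr 6 _⊞_

mutual
  _⊞_ : Game → Game → Game
  ⟨ gs ⟩ ⊞ ⟨ hs ⟩ = ⟨ moveˡ gs ⟨ hs ⟩ ++ moveʳ ⟨ gs ⟩ hs ⟩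

  moveˡ : List Game → Game → List Game
  moveˡ []       H = []
  moveˡ (g ∷ gs) H = (g ⊞ H) ∷ moveˡ gs H

  moveʳ : Game → List Game → List Game
  moveʳ G []       = []
  moveʳ G (h ∷ hs) = (G ⊞ h) ∷ moveʳ G hs

⨁ : List Game → Game
⨁ = foldr _⊞_ ⟨ [] ⟩

-- mexFrom xs f k searches k, k + 1, … for a number outside xs, giving up
-- at k + f. Since suc (max 0 xs) ∉ xs, mex never gives up too early.

mexFrom : List ℕ → ℕ → ℕ → ℕ
mexFrom xs zero    k = k
mexFrom xs (suc f) k = if does (mem? _≟_ k xs) then mexFrom xs f (suc k) else k

mex : List ℕ → ℕ
mex xs = mexFrom xs (suc (max 0 xs)) 0

private
  mexFrom-∉ : ∀ xs f k → f + k ∉ xs → mexFrom xs f k ∉ xs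
  mexFrom-∉ xs zero    k k∉ = k∉
  mexFrom-∉ xs (suc f) k k∉ with mem? _≟_ k xs
  ... | yes _   = mexFrom-∉ xs f (suc k) (k∉ ∘ subst (_∈ xs) (+-suc f k))
  ... | no  k∉′ = k∉′

  <mexFrom⇒∈ : ∀ xs f k → (∀ {j} → j < k → j ∈ xs) → ∀ {j} → j < mexFrom xs f k → j ∈ xs
  <mexFrom⇒∈ xs zero    k below = below
  <mexFrom⇒∈ xs (suc f) k below with mem? _≟_ k xs
  ... | no  _  = below
  ... | yes k∈ = <mexFrom⇒∈ xs f (suc k) below′
    where
    below′ : ∀ {j} → j < suc k → j ∈ xs
    below′ j<1+k with m<1+n⇒m<n∨m≡n j<1+k
    ... | inj₁ j<k  = below j<k
    ... | inj₂ refl = k∈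

mex-∉ : ∀ xs → mex xs ∉ xs
mex-∉ xs = mexFrom-∉ xs (suc (max 0 xs)) 0 bound
  where
  bound : suc (max 0 xs) + 0 ∉ xs
  bound b∈ rewrite +-identityʳ (max 0 xs) =
    <-irrefl refl (All.lookup (xs≤max 0 xs) b∈)

<mex⇒∈ : ∀ xs {j} → j < mex xs → j ∈ xs
<mex⇒∈ xs = <mexFrom⇒∈ xs (suc (max 0 xs)) 0 (λ ())

-- grundys is map grundy, written out for the termination checker.

mutual
  grundy : Game → ℕ
  grundy ⟨ gs ⟩ = mex (grundys gs)

  grundys : List Game → List ℕ
  grundys []       = []
  grundys (g ∷ gs) = grundy g ∷ grundys gs

Factoring : ℕ → List ℕ → Set
Factoring n as = 2 ≤ length as × All (1 <_) as × Linked _≤_ as × product as ≡ n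

factoring? : ∀ n as → Dec (Factoring n as)
factoring? n as =
  (2 ≤? length as) ×-dec All.all? (1 <?_) as ×-dec linked? _≤?_ as ×-dec (product as ≟ n)

listsUpTo : ℕ → List ℕ → List (List ℕ)
listsUpTo zero    xs = [] ∷ []
listsUpTo (suc k) xs = [] ∷ cartesianProductWith _∷_ xs (listsUpTo k xs)

divisors : ℕ → List ℕ
divisors n = filter (_∣? n) (upTo (suc n))

-- All components of a factoring of n are divisors of n, and there are at most
-- ⌊log₂ n ⌋ of them.

factorings : ℕ → List (List ℕ)
factorings n = filter (factoring? n) (listsUpTo ⌊log₂ n ⌋ (divisors n))

private
  ∈-listsUpTo : ∀ {k xs as} → length as ≤ k → All (_∈ xs) as → as ∈ listsUpTo k xs
  ∈-listsUpTo {zero}  z≤n       []         = here refl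
  ∈-listsUpTo {suc k} z≤n       []         = here refl
  ∈-listsUpTo {suc k} (s≤s len) (a∈ ∷ as∈) =
    there (∈-cartesianProductWith⁺ _∷_ a∈ (∈-listsUpTo len as∈))

  2^length≤product : ∀ {as} → All (1 <_) as → 2 ^ length as ≤ product as
  2^length≤product []         = ≤-refl
  2^length≤product (1<a ∷ ps) = *-mono-≤ 1<a (2^length≤product ps)

  product>0 : ∀ {as} → All (1 <_) as → 0 < product as
  product>0 []         = ≤-refl
  product>0 (1<a ∷ ps) = *-mono-≤ (<⇒≤ 1<a) (product>0 ps)

  length≤log : ∀ {as} → All (1 <_) as → length as ≤ ⌊log₂ product as ⌋
  length≤log {as} ps = subst (_≤ ⌊log₂ product as ⌋) (⌊log₂[2^n]⌋≡n (length as))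
    (⌊log₂⌋-mono-≤ (2^length≤product ps))

  ∈-divisors : ∀ {d n} → .{{NonZero n}} → d ∣ n → d ∈ divisors n
  ∈-divisors {n = n} d∣n = ∈-filter⁺ (_∣? n) (∈-upTo⁺ (s≤s (∣⇒≤ d∣n))) d∣n

∈-factorings : ∀ n as → as ∈ factorings n ⇔ Factoring n as
∈-factorings n as = mk⇔ (proj₂ ∘ ∈-filter⁻ (factoring? n) {xs = candidates}) complete
  where
  candidates = listsUpTo ⌊log₂ n ⌋ (divisors n)

  complete : Factoring n as → as ∈ factorings n
  complete F@(_ , ps , _ , refl) = ∈-filter⁺ (factoring? n)
    (∈-listsUpTo (length≤log ps)
      (All.tabulate (λ a∈ → ∈-divisors {{>-nonZero (product>0 ps)}} (∈⇒∣product a∈)))) F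

private
  ∈⇒≤product : ∀ {as a} → All (1 <_) as → a ∈ as → a ≤ product as
  ∈⇒≤product ps a∈ = ∣⇒≤ {{>-nonZero (product>0 ps)}} (∈⇒∣product a∈)

component< : ∀ {n as a} → Factoring n as → a ∈ as → a < n
component< {as = a ∷ b ∷ as} (_ , 1<a ∷ 1<b ∷ ps , _ , refl) (here refl) =
  m<m*n a (b * product as) {{>-nonZero (<⇒≤ 1<a)}} (≤-trans 1<b (∈⇒≤product (1<b ∷ ps) (here refl)))
component< {as = a ∷ b ∷ as} (_ , 1<a ∷ ps , _ , refl) (there a∈) =
  ≤-<-trans (∈⇒≤product ps a∈)
    (subst (b * product as <_) (*-comm (b * product as) a)
      (m<m*n (b * product as) a {{>-nonZero (product>0 ps)}} 1<a))
component< {as = []}    (() , _)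
component< {as = _ ∷ []} (s≤s () , _)

-- The heap game in which n may be replaced by the sum of the components of
-- any factoring of n that satisfies P

module FactoringGame {P : Pred (List ℕ) 0ℓ} (P? : Decidable P) where

  moves : ℕ → List (List ℕ)
  moves n = filter P? (factorings n)

  private
    move< : ∀ {n as a} → as ∈ moves n → a ∈ as → a < n
    move< {n} as∈ = component<
      (proj₂ (∈-filter⁻ (factoring? n) {xs = listsUpTo ⌊log₂ n ⌋ (divisors n)}
        (proj₁ (∈-filter⁻ P? {xs = factorings n} as∈))))

  heapAcc : ∀ n → Acc _<_ n → Game
  heapAcc n (acc rs) = ⟨ mapWith∈ (moves n) (λ {as} as∈ →
    ⨁ (mapWith∈ as (λ {a} a∈ → heapAcc a (rs (move< as∈ a∈))))) ⟩

  heap : ℕ → Game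
  heap n = heapAcc n (<-wellFounded n)

  private
    heapAcc-unfold : ∀ n (r : Acc _<_ n) →
      heapAcc n r ≡ ⟨ map (λ as → ⨁ (map heap as)) (moves n) ⟩
    heapAcc-irrelevant : ∀ n (r s : Acc _<_ n) → heapAcc n r ≡ heapAcc n s

    heapAcc-irrelevant n (acc rs) (acc ss) = cong ⟨_⟩
      (mapWith∈-cong (moves n) _ _ (λ {as} as∈ → cong ⨁
        (mapWith∈-cong as _ _ (λ {a} a∈ → heapAcc-irrelevant a _ _))))

    heapAcc-unfold n (acc rs) = cong ⟨_⟩ (trans
      (mapWith∈-cong (moves n) _ (λ {as} _ → ⨁ (map heap as)) (λ {as} as∈ → cong ⨁
        (trans (mapWith∈-cong as _ (λ {a} _ → heap a)
                 (λ {a} a∈ → heapAcc-irrelevant a (rs (move< as∈ a∈)) (<-wellFounded a)))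
               (mapWith∈≗map heap as))))
      (mapWith∈≗map _ (moves n)))

  heap-unfold : ∀ n → heap n ≡ ⟨ map (λ as → ⨁ (map heap as)) (moves n) ⟩
  heap-unfold n = heapAcc-unfold n (<-wellFounded n)

  SG : ℕ → ℕ
  SG n = grundy (heap n)

module M-Factoring = FactoringGame {U} U?

NoCommonPrime : ℕ → ℕ → Set
NoCommonPrime a b = ∀ p → Prime p → ¬ (p ∣ a × p ∣ b)

private
  primeDivisor : ∀ d → ¬ d ≡ 1 → ¬ (∀ p → Prime p → ¬ p ∣ d)
  primeDivisor zero    _   none = none 2 prime[2] (2 ∣0)
  primeDivisor (suc d) d≢1 none with factorise (suc d)
  ... | record { factors = []     ; isFactorisation = eq } = d≢1 eq
  ... | record { factors = q ∷ qs ; isFactorisation = eq ; factorsPrime = pq ∷ _ } =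
    none q pq (subst (q ∣_) (sym eq) (m∣m*n (product qs)))

  coprime⇒noCommonPrime : ∀ {a b} → Coprime a b → NoCommonPrime a b
  coprime⇒noCommonPrime c p pp p∣ = ¬prime[1] (subst Prime (c p∣) pp)

  noCommonPrime⇒coprime : ∀ {a b} → NoCommonPrime a b → Coprime a b
  noCommonPrime⇒coprime nc {d} (d∣a , d∣b) with d ≟ 1
  ... | yes d≡1 = d≡1
  ... | no  d≢1 = contradiction
    (λ p pp p∣d → nc p pp (∣-trans p∣d d∣a , ∣-trans p∣d d∣b)) (primeDivisor d d≢1)

noCommonPrime? : ∀ a b → Dec (NoCommonPrime a b)
noCommonPrime? a b = map′ coprime⇒noCommonPrime noCommonPrime⇒coprime (coprime? a b)

-- AllPairs ranges over pairs of positions in the list, so equal components in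
-- different positions, as in 4 = 2 · 2, count as distinct components.

module PrimeDisjointFactoring = FactoringGame {AllPairs NoCommonPrime} (allPairs? noCommonPrime?)

-- The values of Ω and ω at 0 are junk.

Ω : ℕ → ℕ
Ω zero      = 0
Ω n@(suc _) = length (factors (factorise n))

ω : ℕ → ℕ
ω zero      = 0
ω n@(suc _) = length (deduplicate _≟_ (factors (factorise n)))

{-# OPTIONS --safe #-}

-- The length of a longest play is additive under sums and bounds the Grundy
-- value from above; it shows that an option of n with k ≥ 2 components has
-- Grundy value at most Ω(n) − k < Ω(n) − 1. Conversely, multiply together
-- j + 1 of the prime factors of n and leave the others alone: prime components
-- have no moves, so this option has the value j of its composite component.
-- Hence all j < Ω(n) − 1 occur, and neither direction needs nim-sums. For ω the
-- same argument runs with maximal prime powers in the role of the primes.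

module Submission where

open import Defs
open import Data.Nat.Base using (ℕ; _≤_; _∸_)
open import Data.Product.Base using (_×_)
open import Relation.Binary.PropositionalEquality using (_≡_)

open import Data.List.Base using (List; []; _∷_; _++_; map; length; take; drop; deduplicate)
open import Data.List.Membership.Propositional using (_∈_)
open import Data.List.Membership.Propositional.Properties using (∈-filter⁺; ∈-filter⁻; ∈-∃++; ∈-map⁺; ∈-++⁺ˡ; ∈-++⁺ʳ; ∈-++⁻; ∈-deduplicate⁺; ∈-deduplicate⁻)
open import Data.List.Membership.Propositional.Properties.WithK using (unique∧set⇒bag)
open import Data.List.Properties using (length-++; length-take; length-drop; take++drop≡id; map-++; ++-identityʳ)
open import Data.List.Relation.Binary.BagAndSetEquality using (∼bag⇒↭)
open import Data.List.Relation.Binary.Permutation.Propositional using (_↭_; ↭-sym; ↭⇒↭ₛ)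
open import Data.List.Relation.Binary.Permutation.Propositional.Properties using (↭-length; All-resp-↭; ∈-resp-↭; drop-mid)
open import Data.List.Relation.Binary.Permutation.Setoid.Properties using (AllPairs-resp-↭)
open import Data.List.Relation.Unary.All as All using (All; []; _∷_)
import Data.List.Relation.Unary.All.Properties as Allₚ
open import Data.List.Relation.Unary.AllPairs using (AllPairs; allPairs?; []; _∷_)
import Data.List.Relation.Unary.AllPairs.Properties as AllPairsₚ
open import Data.List.Relation.Unary.Any using (here; there)
open import Data.List.Relation.Unary.Unique.Propositional using (Unique)
open import Data.List.Relation.Unary.Unique.Propositional.Properties using () renaming (++⁺ to Unique-++⁺)
open import Data.Nat.Base using (suc; _+_; _*_; _⊔_; _<_; z≤n; s≤s; NonZero; >-nonZero; >-nonZero⁻¹; nonTrivial⇒n>1)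
open import Data.Nat.Divisibility using (_∣_; _∣?_; ∣-refl; ∣m⇒∣m*n; ∣n⇒∣m*n; ∣1⇒≡1)
open import Data.Nat.Induction using (<-rec)
open import Data.Nat.ListAction using (sum; product)
open import Data.Nat.ListAction.Properties using (product-++; product-↭; product≢0; ∈⇒∣product)
open import Data.Nat.Primality using (Prime; euclidsLemma; prime⇒irreducible; prime⇒nonTrivial; prime⇒nonZero; ¬prime[1])
open import Data.Nat.Primality.Factorisation using (PrimeFactorisation; factorise; factors; primeFactorisation[p]; factorisationUnique; factorisationHasAllPrimeFactors)
open import Data.Nat.Properties
open import Algebra.Properties.CommutativeSemigroup *-commutativeSemigroup using (x∙yz≈y∙xz)
open import Data.List.Sort ≤-decTotalOrder using (sort; sort-↭; sort-↗)
open import Data.List.Relation.Unary.Unique.DecPropositional.Properties _≟_ using (deduplicate-!)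
open import Data.Product.Base using (∃-syntax; _,_; proj₁; proj₂)
open import Data.Sum.Base using ([_,_]′; inj₁; inj₂)
open import Data.Unit.Base using (⊤; tt)
open import Function.Base using (_∘_; id)
open import Function.Bundles using (_⇔_; mk⇔; Equivalence)
open import Level using (0ℓ)
open import Relation.Binary.Core using (Rel)
open import Relation.Binary.Definitions using (Symmetric)
open import Relation.Binary.PropositionalEquality using (refl; sym; trans; cong; cong₂; subst; setoid; resp₂)
open import Relation.Nullary.Decidable using (yes; no)
open import Relation.Nullary.Negation using (contradiction)
open import Relation.Unary using (Pred; Decidable)
open import Relation.Unary.Properties using (U?)

open PrimeFactorisation using (isFactorisation; factorsPrime)
open Equivalence using (to; from)

-- Games

mutual
  height : Game → ℕ
  height ⟨ gs ⟩ = heights gs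

  heights : List Game → ℕ
  heights []       = 0
  heights (g ∷ gs) = suc (height g) ⊔ heights gs

heights-++ : ∀ gs hs → heights (gs ++ hs) ≡ heights gs ⊔ heights hs
heights-++ []       hs = refl
heights-++ (g ∷ gs) hs = trans (cong (suc (height g) ⊔_) (heights-++ gs hs))
  (sym (⊔-assoc (suc (height g)) (heights gs) (heights hs)))

heights≤ : ∀ {h gs} → All (λ g → height g < h) gs → heights gs ≤ h
heights≤ []       = z≤n
heights≤ (p ∷ ps) = ⊔-lub p (heights≤ ps)

mutual
  -- A move in a sum is a move in one summand, so each option falls under the induction hypothesis
  -- with one of the two games replaced by an option of it.
  height-⊞ : ∀ G H → height (G ⊞ H) ≤ height G + height H
  height-⊞ ⟨ gs ⟩ ⟨ hs ⟩ = ≤-trans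
    (≤-reflexive (heights-++ (moveˡ gs ⟨ hs ⟩) (moveʳ ⟨ gs ⟩ hs)))
    (⊔-lub (heights-moveˡ gs ⟨ hs ⟩) (heights-moveʳ ⟨ gs ⟩ hs))

  heights-moveˡ : ∀ gs H → heights (moveˡ gs H) ≤ heights gs + height H
  heights-moveˡ []       H = z≤n
  heights-moveˡ (g ∷ gs) H = ⊔-lub
    (≤-trans (s≤s (height-⊞ g H)) (+-monoˡ-≤ (height H) (m≤m⊔n (suc (height g)) (heights gs))))
    (≤-trans (heights-moveˡ gs H) (+-monoˡ-≤ (height H) (m≤n⊔m (suc (height g)) (heights gs))))

  heights-moveʳ : ∀ G hs → heights (moveʳ G hs) ≤ height G + heights hs
  heights-moveʳ G []       = z≤n
  heights-moveʳ G (h ∷ hs) = ⊔-lub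
    (≤-trans (s≤s (height-⊞ G h)) (≤-trans (≤-reflexive (sym (+-suc (height G) (height h))))
      (+-monoʳ-≤ (height G) (m≤m⊔n (suc (height h)) (heights hs)))))
    (≤-trans (heights-moveʳ G hs) (+-monoʳ-≤ (height G) (m≤n⊔m (suc (height h)) (heights hs))))

height≤0⇒empty : ∀ G → height G ≤ 0 → G ≡ ⟨ [] ⟩
height≤0⇒empty ⟨ [] ⟩     _   = refl
height≤0⇒empty ⟨ g ∷ gs ⟩ h≤0 with () ← m⊔n≤o⇒m≤o (suc (height g)) (heights gs) h≤0

mutual
  -- Were the mex larger than the height, the height itself would be the Grundy value of some
  -- option; but options have smaller height, hence smaller value.
  grundy≤height : ∀ G → grundy G ≤ height G
  grundy≤height ⟨ gs ⟩ = ≮⇒≥ λ h<mex →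
    <-irrefl refl (All.lookup (grundys<heights gs) (<mex⇒∈ (grundys gs) h<mex))

  grundys<heights : ∀ gs → All (_< heights gs) (grundys gs)
  grundys<heights []       = []
  grundys<heights (g ∷ gs) =
    ≤-trans (s≤s (grundy≤height g)) (m≤m⊔n (suc (height g)) (heights gs)) ∷
    All.map (λ p → ≤-trans p (m≤n⊔m (suc (height g)) (heights gs))) (grundys<heights gs)

grundys-map : ∀ gs → grundys gs ≡ map grundy gs
grundys-map []       = refl
grundys-map (g ∷ gs) = cong (grundy g ∷_) (grundys-map gs)

-- A mex below `m` would itself be the value of some option, which the mex excludes.
≤grundy : ∀ {m} gs → (∀ {j} → j < m → ∃[ g ] g ∈ gs × grundy g ≡ j) → m ≤ grundy ⟨ gs ⟩
≤grundy gs reach = ≮⇒≥ λ mex<m → let g , g∈ , eq = reach mex<m in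
  mex-∉ (grundys gs) (subst (_∈ grundys gs) eq
    (subst (grundy g ∈_) (sym (grundys-map gs)) (∈-map⁺ grundy g∈)))

-- Sums with empty summands

mutual
  -- The equality is one of game trees, not just of values; this is what lets nim-sums be avoided.
  ⊞-identityˡ : ∀ G → ⟨ [] ⟩ ⊞ G ≡ G
  ⊞-identityˡ ⟨ gs ⟩ = cong ⟨_⟩ (moveʳ-identity gs)

  moveʳ-identity : ∀ gs → moveʳ ⟨ [] ⟩ gs ≡ gs
  moveʳ-identity []       = refl
  moveʳ-identity (g ∷ gs) = cong₂ _∷_ (⊞-identityˡ g) (moveʳ-identity gs)

mutual
  ⊞-identityʳ : ∀ G → G ⊞ ⟨ [] ⟩ ≡ G
  ⊞-identityʳ ⟨ gs ⟩ = cong ⟨_⟩ (trans (++-identityʳ _) (moveˡ-identity gs))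

  moveˡ-identity : ∀ gs → moveˡ gs ⟨ [] ⟩ ≡ gs
  moveˡ-identity []       = refl
  moveˡ-identity (g ∷ gs) = cong₂ _∷_ (⊞-identityʳ g) (moveˡ-identity gs)

⨁-empty : ∀ {Gs} → All (_≡ ⟨ [] ⟩) Gs → ⨁ Gs ≡ ⟨ [] ⟩
⨁-empty []          = refl
⨁-empty (refl ∷ es) = trans (⊞-identityˡ _) (⨁-empty es)

⨁-single : ∀ {Gs G Hs} → All (_≡ ⟨ [] ⟩) Gs → All (_≡ ⟨ [] ⟩) Hs → ⨁ (Gs ++ G ∷ Hs) ≡ G
⨁-single {G = G} []          es′ = trans (cong (G ⊞_) (⨁-empty es′)) (⊞-identityʳ G)
⨁-single         (refl ∷ es) es′ = trans (⊞-identityˡ _) (⨁-single es es′)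

-- Sums of game trees do not commute up to `≡`, since options are listed in order. The position of
-- `a` is nevertheless irrelevant, as everything around it is empty.
⨁-single-↭ : ∀ (f : ℕ → Game) {as a bs} → as ↭ a ∷ bs → All (λ b → f b ≡ ⟨ [] ⟩) bs →
  ⨁ (map f as) ≡ f a
⨁-single-↭ f {a = a} as↭ es with ∈-∃++ (∈-resp-↭ (↭-sym as↭) (here refl))
... | xs , ys , refl =
  -- `drop-mid` cancels `a`, so what surrounds it is a permutation of `bs`.
  let es′ = Allₚ.++⁻ xs (All-resp-↭ (↭-sym (drop-mid xs [] as↭)) es) in
  trans (cong ⨁ (map-++ f xs (a ∷ ys))) (⨁-single (Allₚ.map⁺ (proj₁ es′)) (Allₚ.map⁺ (proj₂ es′)))

1<⇒nonZero : ∀ {a} → 1 < a → NonZero a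
1<⇒nonZero 1<a = >-nonZero (<⇒≤ 1<a)

product-nonZero : ∀ {as} → All (1 <_) as → NonZero (product as)
product-nonZero 1<as = product≢0 (All.map 1<⇒nonZero 1<as)

-- Factoring games whose components are pairwise R-related, for a weight W that
-- is additive on R-related factors.

module WeightedFactoring
  {P : Pred (List ℕ) 0ℓ} (P? : Decidable P)
  (R : Rel ℕ 0ℓ) (P⇔R : ∀ {as} → P as ⇔ AllPairs R as)
  (R-sym : Symmetric R)
  (R-1 : ∀ {a} → R a 1)
  (R-* : ∀ {a b c} → R a b → R a c → R a (b * c))
  (W : ℕ → ℕ)
  (W-1 : W 1 ≡ 0)
  (W-* : ∀ a b → .{{NonZero a}} → .{{NonZero b}} → R a b → W (a * b) ≡ W a + W b)
  (W>0 : ∀ {a} → 1 < a → 0 < W a)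
  (atoms : ∀ n → .{{NonZero n}} →
    ∃[ qs ] All (1 <_) qs × All (λ q → W q ≡ 1) qs × AllPairs R qs × product qs ≡ n)
  where

  open FactoringGame P?

  -- Weights of products

  R-product : ∀ {a bs} → All (R a) bs → R a (product bs)
  R-product []       = R-1
  R-product (r ∷ rs) = R-* r (R-product rs)

  -- Needed when a block of atoms is merged into one component: the result must stay related to the
  -- atoms left alone.
  R-productˡ : ∀ as {bs} → AllPairs R (as ++ bs) → All (R (product as)) bs
  R-productˡ as {bs} rs = All.tabulate λ b∈ → R-sym (R-product (All.tabulate λ a∈ →
    R-sym (related as rs a∈ b∈)))
    where
    related : ∀ as {bs a b} → AllPairs R (as ++ bs) → a ∈ as → b ∈ bs → R a b
    related (a ∷ as) (r ∷ rs) (here refl) b∈ = All.lookup r (∈-++⁺ʳ as b∈)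
    related (a ∷ as) (r ∷ rs) (there a∈)  b∈ = related as rs a∈ b∈

  W-product : ∀ {as} → All (1 <_) as → AllPairs R as → W (product as) ≡ sum (map W as)
  W-product          []           []       = W-1
  W-product {a ∷ as} (1<a ∷ 1<as) (r ∷ rs) = trans
    (W-* a (product as) {{1<⇒nonZero 1<a}} {{product-nonZero 1<as}} (R-product r))
    (cong (W a +_) (W-product 1<as rs))

  W-atoms : ∀ {qs} → All (1 <_) qs → All (λ q → W q ≡ 1) qs → AllPairs R qs →
    W (product qs) ≡ length qs
  W-atoms 1<qs Wqs rs = trans (W-product 1<qs rs) (sum-ones Wqs)
    where
    sum-ones : ∀ {qs} → All (λ q → W q ≡ 1) qs → sum (map W qs) ≡ length qs
    sum-ones []         = refl
    sum-ones (eq ∷ eqs) = cong₂ _+_ eq (sum-ones eqs)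

  -- Moves and the upper bound

  ∈-moves⁻ : ∀ {n as} → as ∈ moves n → Factoring n as × AllPairs R as
  ∈-moves⁻ {n} {as} as∈ = let as∈f , p = ∈-filter⁻ P? {xs = factorings n} as∈ in
    to (∈-factorings n as) as∈f , to P⇔R p

  ∈-moves⁺ : ∀ {n as} → Factoring n as → AllPairs R as → as ∈ moves n
  ∈-moves⁺ {n} {as} F rs = ∈-filter⁺ P? (from (∈-factorings n as) F) (from P⇔R rs)

  -- Each component's height falls short of its weight by at least one, so the sum falls short by
  -- the number of components. That number stands on the left to avoid truncated subtraction.
  height-⨁ : ∀ {as} → All (λ a → height (heap a) < W a) as →
    length as + height (⨁ (map heap as)) ≤ sum (map W as)
  height-⨁          []         = z≤n
  height-⨁ {a ∷ as} (h< ∷ hs<) = begin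
    suc (length as + height (heap a ⊞ G))            ≤⟨ s≤s (+-monoʳ-≤ (length as) (height-⊞ (heap a) G)) ⟩
    suc (length as + (height (heap a) + height G))   ≡⟨ cong suc (+-assoc (length as) (height (heap a)) (height G)) ⟨
    suc (length as + height (heap a) + height G)     ≡⟨ cong (λ x → suc (x + height G)) (+-comm (length as) (height (heap a))) ⟩
    suc (height (heap a) + length as + height G)     ≡⟨ cong suc (+-assoc (height (heap a)) (length as) (height G)) ⟩
    suc (height (heap a)) + (length as + height G)   ≤⟨ +-mono-≤ h< (height-⨁ hs<) ⟩
    W a + sum (map W as)                             ∎
    where
    open ≤-Reasoning
    G = ⨁ (map heap as)

  height-heap : ∀ n → 1 < n → height (heap n) < W n
  height-heap = <-rec (λ n → 1 < n → height (heap n) < W n) step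
    where
    step : ∀ n → (∀ {m} → m < n → 1 < m → height (heap m) < W m) → 1 < n → height (heap n) < W n
    step n rec 1<n = subst (λ G → height G < W n) (sym (heap-unfold n))
      -- Positivity of `W n` makes its predecessor exact. Every option has height at most `W n`
      -- minus 2, so the heap has height at most `W n` minus 1.
      (m≤pred[n]⇒suc[m]≤n {{>-nonZero (W>0 1<n)}}
        (heights≤ (Allₚ.map⁺ (All.tabulate λ as∈ → ∸-monoˡ-≤ 1 (option as∈)))))
      where
      option : ∀ {as} → as ∈ moves n → 2 + height (⨁ (map heap as)) ≤ W n
      option {as} as∈ = let F@(2≤len , 1<as , _ , eq) , rs = ∈-moves⁻ as∈ in begin
        2 + height (⨁ (map heap as))          ≤⟨ +-monoˡ-≤ _ 2≤len ⟩
        length as + height (⨁ (map heap as))  ≤⟨ height-⨁ (All.tabulate λ a∈ → rec (component< F a∈) (All.lookup 1<as a∈)) ⟩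
        sum (map W as)                        ≡⟨ W-product 1<as rs ⟨
        W (product as)                        ≡⟨ cong W eq ⟩
        W n                                   ∎
        where open ≤-Reasoning

  -- The lower bound

  atomic-empty : ∀ {q} → 1 < q → W q ≡ 1 → heap q ≡ ⟨ [] ⟩
  atomic-empty {q} 1<q eq = height≤0⇒empty (heap q) (≤-pred (subst (_ <_) eq (height-heap q 1<q)))

  -- The component `a` merges `suc j` atoms of `n`. The remaining components are single atoms, whose
  -- heaps are empty, so the whole option equals the heap `a`.
  move-to-weight : ∀ {n j} → .{{NonZero n}} → suc j < W n → ∃[ a ] ∃[ as ]
    W a ≡ suc j × as ∈ moves n × a ∈ as × ⨁ (map heap as) ≡ heap a
  move-to-weight {n} {j} 1+j<W with atoms n
  ... | qs , 1<qs , Wqs , rs , refl =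
    a , as , Wa≡ , ∈-moves⁺ F rs′ , ∈-resp-↭ (↭-sym as↭) (here refl) ,
    ⨁-single-↭ heap as↭ (All.zipWith (λ (1<b , Wb) → atomic-empty 1<b Wb) (1<bs , Allₚ.drop⁺ k Wqs))
    where
    k  = suc j
    a  = product (take k qs)
    bs = drop k qs
    -- Components of a factoring must be in nondecreasing order, and the place of `a` among the
    -- atoms is unknown.
    as = sort (a ∷ bs)

    as↭ : as ↭ a ∷ bs
    as↭ = sort-↭ (a ∷ bs)

    k<len : k < length qs
    k<len = subst (k <_) (W-atoms 1<qs Wqs rs) 1+j<W

    1<ts : All (1 <_) (take k qs)
    1<ts = Allₚ.take⁺ k 1<qs

    1<bs : All (1 <_) bs
    1<bs = Allₚ.drop⁺ k 1<qs

    Wa≡ : W a ≡ k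
    Wa≡ = trans (W-atoms 1<ts (Allₚ.take⁺ k Wqs) (AllPairsₚ.take⁺ k rs))
      (trans (length-take k qs) (m≤n⇒m⊓n≡m (<⇒≤ k<len)))

    1<a : 1 < a
    -- The weight `suc j` of `a` is nonzero, whereas 1 has weight 0.
    1<a = ≤∧≢⇒< (>-nonZero⁻¹ a {{product-nonZero 1<ts}})
      λ 1≡a → contradiction (trans (sym Wa≡) (trans (cong W (sym 1≡a)) W-1)) λ ()

    F : Factoring (product qs) as
    -- Strictness of `k<len` leaves at least one atom besides `a`.
    F = subst (2 ≤_) (sym (↭-length as↭))
          (s≤s (subst (0 <_) (sym (length-drop k qs)) (m<n⇒0<n∸m k<len)))
      , All-resp-↭ (↭-sym as↭) (1<a ∷ 1<bs)
      , sort-↗ (a ∷ bs)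
      , trans (product-↭ as↭) (trans (sym (product-++ (take k qs) bs)) (cong product (take++drop≡id k qs)))

    rs′ : AllPairs R as
    rs′ = AllPairs-resp-↭ (setoid ℕ) R-sym (resp₂ R) (↭⇒↭ₛ (↭-sym as↭))
      (R-productˡ (take k qs) (subst (AllPairs R) (sym (take++drop≡id k qs)) rs) ∷ AllPairsₚ.drop⁺ k rs)

  -- The height gives the upper bound. For the lower one, a value `j` is reached through a component
  -- of weight `suc j`, which is smaller than `n` and so has value `j` by induction.
  SG≡W∸1 : ∀ n → 1 < n → SG n ≡ W n ∸ 1
  SG≡W∸1 = <-rec (λ n → 1 < n → SG n ≡ W n ∸ 1) step
    where
    step : ∀ n → (∀ {m} → m < n → 1 < m → SG m ≡ W m ∸ 1) → 1 < n → SG n ≡ W n ∸ 1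
    step n rec 1<n = ≤-antisym
      (≤-trans (grundy≤height (heap n)) (∸-monoˡ-≤ 1 (height-heap n 1<n)))
      (subst (λ G → W n ∸ 1 ≤ grundy G) (sym (heap-unfold n)) (≤grundy _ reach))
      where
      reach : ∀ {j} → j < W n ∸ 1 →
        ∃[ G ] G ∈ map (λ as → ⨁ (map heap as)) (moves n) × grundy G ≡ j
      reach {j} j<W∸1 =
        let a , as , Wa , as∈ , a∈ , eq = move-to-weight {{1<⇒nonZero 1<n}} (m≤pred[n]⇒suc[m]≤n {{>-nonZero (W>0 1<n)}} j<W∸1)
            F@(_ , 1<as , _) , _ = ∈-moves⁻ as∈
        in ⨁ (map heap as) , ∈-map⁺ _ as∈ ,
           trans (cong grundy eq) (trans (rec (component< F a∈) (All.lookup 1<as a∈)) (cong (_∸ 1) Wa))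

-- Ω and ω

AllPairs-⊤ : ∀ (as : List ℕ) → AllPairs (λ _ _ → ⊤) as
AllPairs-⊤ []       = []
AllPairs-⊤ (_ ∷ as) = All.universal (λ _ → tt) as ∷ AllPairs-⊤ as

prime>1 : ∀ {p} → Prime p → 1 < p
prime>1 {p} pp = nonTrivial⇒n>1 p {{prime⇒nonTrivial pp}}

-- Uniqueness of factorisation lets any prime factorisation be used for counting, in particular a
-- concatenation of two.
Ω≡length : ∀ n → .{{_ : NonZero n}} (f : PrimeFactorisation n) → Ω n ≡ length (factors f)
Ω≡length n@(suc _) f = ↭-length (factorisationUnique (factorise n) f)

Ω-* : ∀ a b → .{{NonZero a}} → .{{NonZero b}} → Ω (a * b) ≡ Ω a + Ω b
Ω-* a b = trans (Ω≡length (a * b) {{m*n≢0 a b}} ab) (trans (length-++ (factors fa))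
    (sym (cong₂ _+_ (Ω≡length a fa) (Ω≡length b fb))))
  where
  fa = factorise a
  fb = factorise b
  ab : PrimeFactorisation (a * b)
  ab = record
    { factors = factors fa ++ factors fb
    ; isFactorisation = trans (cong₂ _*_ (isFactorisation fa) (isFactorisation fb))
        (sym (product-++ (factors fa) (factors fb)))
    ; factorsPrime = Allₚ.++⁺ (factorsPrime fa) (factorsPrime fb)
    }

Ω-prime : ∀ {p} → Prime p → Ω p ≡ 1
Ω-prime {p} pp = Ω≡length p {{prime⇒nonZero pp}}
  (primeFactorisation[p] pp)

Ω-atoms : ∀ n → .{{NonZero n}} →
  ∃[ qs ] All (1 <_) qs × All (λ q → Ω q ≡ 1) qs × AllPairs (λ _ _ → ⊤) qs × product qs ≡ n
Ω-atoms n = factors f , All.map prime>1 (factorsPrime f) , All.map Ω-prime (factorsPrime f) ,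
  AllPairs-⊤ (factors f) , sym (isFactorisation f)
  where
  f = factorise n

Ω>0 : ∀ {n} → 1 < n → 0 < Ω n
Ω>0 {n@(suc _)} 1<n with factorise n
... | record { factors = []    ; isFactorisation = eq } = contradiction (sym eq) (<⇒≢ 1<n)
... | record { factors = _ ∷ _ }                        = s≤s z≤n

-- Counting distinct primes

prime∣prime⇒≡ : ∀ {p q} → Prime p → Prime q → p ∣ q → p ≡ q
prime∣prime⇒≡ pp pq p∣q with prime⇒irreducible pq p∣q
... | inj₁ refl = contradiction pp ¬prime[1]
... | inj₂ p≡q  = p≡q

∈-factors : ∀ {n p} (f : PrimeFactorisation n) → p ∈ factors f ⇔ (Prime p × p ∣ n)
∈-factors {n} {p} f = mk⇔
  (λ p∈ → All.lookup (factorsPrime f) p∈ , subst (p ∣_) (sym (isFactorisation f)) (∈⇒∣product p∈))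
  (λ (pp , p∣n) → factorisationHasAllPrimeFactors pp (subst (p ∣_) (isFactorisation f) p∣n) (factorsPrime f))

PrimesOf : ℕ → List ℕ → Set
PrimesOf n ps = Unique ps × (∀ {p} → p ∈ ps ⇔ (Prime p × p ∣ n))

dedup-PrimesOf : ∀ {n} (f : PrimeFactorisation n) → PrimesOf n (deduplicate _≟_ (factors f))
dedup-PrimesOf f = deduplicate-! (factors f) , mk⇔
  (λ p∈ → to (∈-factors f) (∈-deduplicate⁻ _≟_ (factors f) p∈))
  (λ p∣ → ∈-deduplicate⁺ _≟_ (from (∈-factors f) p∣))

-- Duplicate-free lists with the same members are permutations of each other.
ω≡length : ∀ {n ps} → .{{NonZero n}} → PrimesOf n ps → ω n ≡ length ps
ω≡length {n@(suc _)} (ps! , ps⇔) = let qs! , qs⇔ = dedup-PrimesOf (factorise n) in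
  ↭-length (∼bag⇒↭ (unique∧set⇒bag qs! ps! (mk⇔ (from ps⇔ ∘ to qs⇔) (from qs⇔ ∘ to ps⇔))))

primesOf : ∀ n → .{{NonZero n}} → ∃[ ps ] PrimesOf n ps
primesOf n = _ , dedup-PrimesOf (factorise n)

ω>0 : ∀ {n} → 1 < n → 0 < ω n
ω>0 {n@(suc _)} 1<n with factorise n
... | record { factors = []    ; isFactorisation = eq } = contradiction (sym eq) (<⇒≢ 1<n)
... | record { factors = _ ∷ _ }                        = s≤s z≤n

ω-prime : ∀ {p} → Prime p → ω p ≡ 1
ω-prime {p} pp = ω≡length {{prime⇒nonZero pp}} (([] ∷ []) , mk⇔
  (λ { (here refl) → pp , ∣-refl })
  (λ (pq , q∣p) → here (prime∣prime⇒≡ pq pp q∣p)))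

-- Disjointness keeps the concatenated lists of primes duplicate-free; Euclid's lemma shows that no
-- prime of the product is missed.
ω-* : ∀ a b → .{{NonZero a}} → .{{NonZero b}} → NoCommonPrime a b → ω (a * b) ≡ ω a + ω b
ω-* a b disjoint =
  let ps , Pa@(ps! , ps⇔) = primesOf a
      qs , Pb@(qs! , qs⇔) = primesOf b
      unique = Unique-++⁺ ps! qs! λ (p∈ , q∈) →
        disjoint _ (proj₁ (to ps⇔ p∈)) (proj₂ (to ps⇔ p∈) , proj₂ (to qs⇔ q∈))
      sound : ∀ {p} → p ∈ ps ++ qs → Prime p × p ∣ a * b
      sound p∈ = [ (λ p∈ps → let pp , p∣a = to ps⇔ p∈ps in pp , ∣m⇒∣m*n b p∣a)
                 , (λ p∈qs → let pp , p∣b = to qs⇔ p∈qs in pp , ∣n⇒∣m*n a p∣b) ]′ (∈-++⁻ ps p∈)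
      complete : ∀ {p} → Prime p × p ∣ a * b → p ∈ ps ++ qs
      complete (pp , p∣ab) = [ (λ p∣a → ∈-++⁺ˡ (from ps⇔ (pp , p∣a)))
                             , (λ p∣b → ∈-++⁺ʳ ps (from qs⇔ (pp , p∣b))) ]′ (euclidsLemma a b pp p∣ab)
  in trans (ω≡length {{m*n≢0 a b}} (unique , mk⇔ sound complete))
       (trans (length-++ ps) (sym (cong₂ _+_ (ω≡length Pa) (ω≡length Pb))))

∣p*n : ∀ {p q n} → Prime p → Prime q → p ∣ n → q ∣ p * n → q ∣ n
∣p*n {p} {q} {n} pp pq p∣n q∣pn with euclidsLemma p n pq q∣pn
... | inj₂ q∣n = q∣n
... | inj₁ q∣p = subst (_∣ n) (sym (prime∣prime⇒≡ pq pp q∣p)) p∣n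

-- Both numbers have the same prime divisors, so one list counts for both.
ω-absorb : ∀ {p n} → .{{NonZero n}} → Prime p → p ∣ n → ω (p * n) ≡ ω n
ω-absorb {p} {n} pp p∣n = let ps , Pn@(ps! , ps⇔) = primesOf n in
  trans (ω≡length {{m*n≢0 p n {{prime⇒nonZero pp}}}} (ps! , mk⇔
      (λ q∈ → let pq , q∣n = to ps⇔ q∈ in pq , ∣n⇒∣m*n p q∣n)
      (λ (pq , q∣pn) → from ps⇔ (pq , ∣p*n pp pq p∣n q∣pn))))
    (sym (ω≡length Pn))

-- Coprime components and maximal prime powers

noCommonPrime-sym : Symmetric NoCommonPrime
noCommonPrime-sym nc p pp (p∣b , p∣a) = nc p pp (p∣a , p∣b)

noCommonPrime-1 : ∀ {a} → NoCommonPrime a 1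
noCommonPrime-1 p pp (_ , p∣1) = ¬prime[1] (subst Prime (∣1⇒≡1 p∣1) pp)

noCommonPrime-* : ∀ {a b c} → NoCommonPrime a b → NoCommonPrime a c → NoCommonPrime a (b * c)
noCommonPrime-* {b = b} {c} ab ac p pp (p∣a , p∣bc) with euclidsLemma b c pp p∣bc
... | inj₁ p∣b = ab p pp (p∣a , p∣b)
... | inj₂ p∣c = ac p pp (p∣a , p∣c)

-- Multiplies p into the component that p already divides, if there is one.

absorb : ℕ → List ℕ → List ℕ
absorb p []       = p ∷ []
absorb p (q ∷ qs) with p ∣? q
... | yes _ = p * q ∷ qs
... | no  _ = q ∷ absorb p qs

absorb-product : ∀ p qs → product (absorb p qs) ≡ p * product qs
absorb-product p []       = refl
absorb-product p (q ∷ qs) with p ∣? q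
... | yes _ = *-assoc p q (product qs)
... | no  _ = trans (cong (q *_) (absorb-product p qs)) (x∙yz≈y∙xz q p (product qs))

-- The second premise may assume `p ∣ q`. Its uses rely on this: multiplying by `p` then brings in
-- no new prime.
absorb-All : ∀ {Q : Pred ℕ 0ℓ} {p qs} → Q p → (∀ {q} → p ∣ q → Q q → Q (p * q)) →
  All Q qs → All Q (absorb p qs)
absorb-All                 Qp Q* []         = Qp ∷ []
absorb-All {p = p} {q ∷ _} Qp Q* (Qq ∷ Qqs) with p ∣? q
... | yes p∣q = Q* p∣q Qq ∷ Qqs
... | no  _   = Qq ∷ absorb-All Qp Q* Qqs

noCommonPrime-absorb : ∀ {p a b} → Prime p → p ∣ b → NoCommonPrime a b → NoCommonPrime a (p * b)
noCommonPrime-absorb pp p∣b nc q pq (q∣a , q∣pb) = nc q pq (q∣a , ∣p*n pp pq p∣b q∣pb)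

-- If `p` divides the head, the head gains no new prime. If not, the head shares no prime with `p`,
-- so it stays coprime to whichever later entry receives `p`.
absorb-AllPairs : ∀ {p qs} → Prime p → AllPairs NoCommonPrime qs → AllPairs NoCommonPrime (absorb p qs)
absorb-AllPairs pp [] = [] ∷ []
absorb-AllPairs {p} {q ∷ _} pp (nc ∷ ncs) with p ∣? q
... | yes p∣q = All.map (λ c → noCommonPrime-sym (noCommonPrime-absorb pp p∣q (noCommonPrime-sym c))) nc ∷ ncs
... | no  p∤q = absorb-All coprime (noCommonPrime-absorb pp) nc ∷ absorb-AllPairs pp ncs
  where
  coprime : NoCommonPrime q p
  coprime r pr (r∣q , r∣p) = p∤q (subst (_∣ q) (prime∣prime⇒≡ pr pp r∣p) r∣q)

ω-atoms : ∀ n → .{{NonZero n}} →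
  ∃[ qs ] All (1 <_) qs × All (λ q → ω q ≡ 1) qs × AllPairs NoCommonPrime qs × product qs ≡ n
ω-atoms n = let qs , atomic , ncs , eq = go (factorsPrime f) in
  qs , All.map proj₁ atomic , All.map proj₂ atomic , ncs , trans eq (sym (isFactorisation f))
  where
  f = factorise n

  -- Absorbing the prime factors one by one gathers equal primes, which yields the maximal prime
  -- powers of `n`.
  go : ∀ {ps} → All Prime ps →
    ∃[ qs ] All (λ q → 1 < q × ω q ≡ 1) qs × AllPairs NoCommonPrime qs × product qs ≡ product ps
  go []                     = [] , [] , [] , refl
  go {p ∷ ps} (pp ∷ primes) = let qs , atomic , ncs , eq = go primes in
    absorb p qs ,
    absorb-All (prime>1 pp , ω-prime pp)
      (λ {q} p∣q (1<q , ωq) →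
        ≤-trans 1<q (m≤n*m q p {{prime⇒nonZero pp}}) ,
        trans (ω-absorb {{1<⇒nonZero 1<q}} pp p∣q) ωq)
      atomic ,
    absorb-AllPairs pp ncs ,
    trans (absorb-product p qs) (cong (p *_) eq)

-- The two games as instances

module ΩGame = WeightedFactoring U? (λ _ _ → ⊤) (λ {as} → mk⇔ (λ _ → AllPairs-⊤ as) (λ _ → tt))
  (λ _ → tt) tt (λ _ _ → tt) Ω refl (λ a b _ → Ω-* a b) Ω>0 Ω-atoms

module ωGame = WeightedFactoring (allPairs? noCommonPrime?) NoCommonPrime (mk⇔ id id)
  noCommonPrime-sym noCommonPrime-1 noCommonPrime-* ω refl ω-* ω>0 ω-atoms

mainTheorem13 : (n : ℕ) → 2 ≤ n →
    (M-Factoring.SG n ≡ Ω n ∸ 1) × (PrimeDisjointFactoring.SG n ≡ ω n ∸ 1)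
mainTheorem13 n 2≤n = ΩGame.SG≡W∸1 n 2≤n , ωGame.SG≡W∸1 n 2≤n
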